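{- Let $r\geq 1$ be an integer, let $k_1,\dots,k_r$ be formal variables, and set $K=\sum_{i=1}^r k_i$. For an unordered increasing tree $T$ with $r$ vertices, define its weight by \[ \mathrm{wt}(T) = \prod_{v=2}^r k_{f(v)} \left( \Big(\sum_{u \in \mathfrak{h}_T(v)} k_u \Big) - h_T(v) + 1 \right), \] where $f(v)$ is the father of $v$ in $T$, $\mathfrak{h}_T(v)$ is the hook of $v$ in $T$, and $h_T(v)=|\mathfrak{h}_T(v)|$. Then \[ \sum_T \mathrm{wt}(T) = k_1 \cdots k_r\, (K-1)_{r-2}, \] where the sum runs over all unordered increasing trees on $r$ vertices.
   Context: A rooted tree is a tree (acyclic connected graph) with a distinguished vertex, the root. Each edge joins a father (the endpoint closer to the root) to a son (the endpoint farther from the root). The descendants of a vertex are its sons and, recursively, the descendants of its sons. The hook $\mathfrak{h}_T(v)$ of a vertex $v$ in $T$ is the set consisting of $v$ and all its descendants, and $h_T(v)=|\mathfrak{h}_T(v)|$ is its size. An unordered increasing tree with $r$ vertices is a rooted tree whose vertices are labelled by $1,\dots,r$ (each label used exactly once; vertices are identified with their labels) such that the label of a son is always bigger than the label of its father (so the root has label $1$), and where the sons of a given vertex are not ordered. Thus such a tree is determined by its father function $f:\{2,\dots,r\}\to\{1,\dots,r\}$ with $f(v)<v$ for all $v$. Falling factorials: $(a)_m = a(a-1)\cdots(a-m+1)$ for positive integers $m$, $(a)_0=1$, and $(a)_m = 1/(a-m)_{ -m}$ for negative integers $m$. An empty product is $1$. -}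

module Defs where

open import Algebra.Bundles using (CommutativeRing)
import Algebra.Definitions as AlgebraDefinitions
import Algebra.Properties.CommutativeMonoid.Sum as FiniteSum
import Algebra.Properties.Semiring.Mult as Multiple
open import Data.Bool.Base using (if_then_else_)
open import Data.Fin.Base using (Fin; Fin′; zero; suc; toℕ; inject; _<_)
open import Data.Fin.Induction using (<-wellFounded)
open import Data.Fin.Properties using (_≟_; toℕ-inject; toℕ<n; ∀-cons)
open import Data.Fin.Subset using (Subset; ∣_∣)
open import Data.Integer.Base as ℤ using (ℤ; +_; -[1+_])
open import Data.Nat.Base as ℕ using (ℕ; zero; suc)
open import Data.Product.Base using (_×_; _,_; proj₁; ∃-syntax)
open import Data.Sum.Base using (_⊎_; inj₁; inj₂; [_,_]′)
open import Data.Unit.Polymorphic.Base using (⊤)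
open import Data.Vec.Base using (lookup; tabulate)
open import Function.Base using (_∘_)
open import Induction.WellFounded using (Acc; acc)
open import Level using (_⊔_)
open import Relation.Binary.Construct.Closure.Transitive
  using (TransClosure; [_]; _∷_; _∷ʳ_)
open import Relation.Binary.PropositionalEquality.Core using (_≡_; refl; sym; subst)
open import Relation.Nullary.Negation.Core using (¬_)
open import Relation.Nullary.Decidable using (Dec; no; does; map′; _⊎-dec_)

-- An unordered increasing tree with r = suc n vertices, given by its father
-- function. The vertex with label i + 1 is i : Fin (suc n), so the root is
-- zero, the vertices 2, …, r are suc w for w : Fin n, and the father of suc w
-- ranges over the vertices smaller than suc w.
IncreasingTree : ℕ → Set
IncreasingTree n = (w : Fin n) → Fin′ (suc w)

module _ {n : ℕ} (T : IncreasingTree n) where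

  father : Fin n → Fin (suc n)
  father w = inject {i = suc w} (T w)

  father-< : ∀ w → father w < suc w
  father-< w =
    subst (ℕ._< suc (toℕ w)) (sym (toℕ-inject {i = suc w} (T w))) (toℕ<n (T w))

  HasSon : Fin (suc n) → Fin (suc n) → Set
  HasSon v u = ∃[ w ] (u ≡ suc w × father w ≡ v)

  HasDescendant : Fin (suc n) → Fin (suc n) → Set
  HasDescendant = TransClosure HasSon

  root-not-descendant : ∀ {v} → ¬ HasDescendant v zero
  root-not-descendant [ _ , () , _ ]
  root-not-descendant (_ ∷ p) = root-not-descendant p

  via-father : ∀ {v} w →
    father w ≡ v ⊎ HasDescendant v (father w) → HasDescendant v (suc w)
  via-father w (inj₁ eq) = [ w , refl , eq ]
  via-father w (inj₂ p)  = p ∷ʳ (w , refl , refl)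

  via-father⁻¹ : ∀ {v} w →
    HasDescendant v (suc w) → father w ≡ v ⊎ HasDescendant v (father w)
  via-father⁻¹ w [ _ , refl , eq ] = inj₁ eq
  via-father⁻¹ w (s ∷ p) =
    inj₂ ([ (λ { refl → [ s ] }) , (s ∷_) ]′ (via-father⁻¹ w p))

  descendant?-acc : ∀ v u → Acc _<_ u → Dec (HasDescendant v u)
  descendant?-acc v zero    _        = no root-not-descendant
  descendant?-acc v (suc w) (acc rs) =
    map′ (via-father w) (via-father⁻¹ w)
      (father w ≟ v ⊎-dec descendant?-acc v (father w) (rs (father-< w)))

  descendant? : ∀ v u → Dec (HasDescendant v u)
  descendant? v u = descendant?-acc v u (<-wellFounded u)

  hook : Fin (suc n) → Subset (suc n)
  hook v = tabulate λ u → does (u ≟ v ⊎-dec descendant? v u)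

module _ {c ℓ} (R : CommutativeRing c ℓ) where
  open CommutativeRing R
  open AlgebraDefinitions _≈_ using (Invertible)
  open Multiple semiring renaming (_×_ to _·_)

  open FiniteSum +-commutativeMonoid public using (sum)
  open FiniteSum *-commutativeMonoid public using () renaming (sum to product)

  sumOver : ∀ {m} → Subset m → (Fin m → Carrier) → Carrier
  sumOver S k = sum λ u → if lookup S u then k u else 0#

  -- The sum of F over all dependent functions (i : Fin m) → Fin (b i), as an
  -- iterated sum over their successive values.
  sumΠ : ∀ {m} (b : Fin m → ℕ) → ((∀ i → Fin (b i)) → Carrier) → Carrier
  sumΠ {zero}  b F = F λ ()
  sumΠ {suc m} b F =
    sum λ x → sumΠ (b ∘ suc) λ f → F (∀-cons {P = Fin ∘ b} x f)

  sumTrees : ∀ n → (IncreasingTree n → Carrier) → Carrier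
  sumTrees n = sumΠ {n} (λ w → suc (toℕ w))

  weight : ∀ {n} → (Fin (suc n) → Carrier) → IncreasingTree n → Carrier
  weight {n} k T = product {n} λ w →
    k (father T w) *
      ((sumOver (hook T (suc w)) k - ∣ hook T (suc w) ∣ · 1#) + 1#)

  fallingℕ : Carrier → ℕ → Carrier
  fallingℕ a m = product {m} λ i → a - toℕ i · 1#

  -- For negative m, (a)ₘ = 1 / (a - m)₋ₘ makes sense only when the denominator
  -- is invertible. Note that -[1+ m ] stands for -(m + 1).
  FallingDefined : Carrier → ℤ → Set (c ⊔ ℓ)
  FallingDefined a (+ m)    = ⊤
  FallingDefined a -[1+ m ] =
    Invertible 1# _*_ (fallingℕ (a + suc m · 1#) (suc m))

  falling : ∀ a m → FallingDefined a m → Carrier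
  falling a (+ m)    _   = fallingℕ a m
  falling a -[1+ m ] inv = proj₁ inv

{-# OPTIONS --safe #-}

-- The idea is to contract the edge joining 1 and 2. Put x = k - 1. The vertex 2
-- is always a son of 1, and a tree on the contracted vertex set whose root has
-- d ≥ 1 sons lifts by distributing these sons over 1 and 2; if C is the set
-- given to 2, then the factor of 2 becomes k₂ + ∑_{c ∈ C} (sum of x over the
-- hook of c). As the hooks of all sons partition the non-root vertices, the
-- lifts sum up to k₁ k₂ (k₁ + k₂)^(d-1) (K - r + 2) times the other factors, so
-- that the theorem follows by induction on r. The contraction identity holds
-- with the factors k_{f(v)} replaced by variables y_{f(v)} unrelated to x (and
-- k₂ by 1 + x₂); in this generality, removing the last vertex, a leaf with
-- father j, amounts to adding its x to that of j, which gives an induction.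
module Submission where

open import Defs
open import Algebra.Bundles using (CommutativeRing)
open import Data.Bool.Base using (Bool; true; false; if_then_else_)
open import Data.Fin.Base using (Fin; zero; suc; toℕ; fromℕ; fromℕ<; inject₁)
open import Data.Fin.Properties
  using (_≟_; toℕ-fromℕ; toℕ-fromℕ<; toℕ-inject₁; toℕ-inject; toℕ<n; toℕ-injective; ∀-cons)
open import Data.Fin.Subset using (Subset; ∣_∣)
open import Data.Integer.Base as ℤ using (+_)
open import Data.Nat.Base as ℕ using (ℕ; zero; suc)
import Data.Nat.Properties as ℕ
open import Data.Product.Base using (_,_)
open import Data.Sum.Base using (_⊎_; inj₁; inj₂; [_,_]′)
import Data.Vec.Functional as Vector
open import Data.Vec.Base using (lookup; []; _∷_)
open import Data.Vec.Properties using (lookup∘tabulate)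
open import Function.Base using (_∘_)
open import Function.Bundles using (mk⇔)
open import Relation.Binary.Construct.Closure.Transitive using ([_]; _∷_)
open import Relation.Binary.PropositionalEquality.Core as ≡ using (_≡_; _≗_)
open import Relation.Nullary.Decidable using (Dec; _⊎-dec_; does; dec-true; dec-false; does-⇔)
open import Relation.Nullary.Negation.Core using (contradiction)

-- Hooks characterised through the father function

-- D v u stands for u ∈ hook of v, and f w for the father of suc w.
record IsHook {n} (f : Fin n → ℕ) (D : Fin (suc n) → Fin (suc n) → Bool) : Set where
  field
    self    : ∀ v → D v v ≡ true
    below   : ∀ v u → toℕ u ℕ.< toℕ v → D v u ≡ false
    step    : ∀ v w u → toℕ v ℕ.≤ toℕ w → toℕ u ≡ f w → D v (suc w) ≡ D v u
    father≤ : ∀ w → f w ℕ.≤ toℕ w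

-- Fathers precede their sons, so the last vertex is a leaf; deleting it only restricts the hooks of
-- the other vertices.
IsHook-inject₁ : ∀ {n} {f : Fin (suc n) → ℕ} {D} → IsHook f D →
  IsHook (f ∘ inject₁) (λ v u → D (inject₁ v) (inject₁ u))
IsHook-inject₁ {f = f} h = record
  { self    = λ v → self (inject₁ v)
  ; below   = λ v u u<v → below _ _
      (≡.subst₂ ℕ._<_ (≡.sym (toℕ-inject₁ u)) (≡.sym (toℕ-inject₁ v)) u<v)
  ; step    = λ v w u v≤w eq → step _ _ _
      (≡.subst₂ ℕ._≤_ (≡.sym (toℕ-inject₁ v)) (≡.sym (toℕ-inject₁ w)) v≤w)
      (≡.trans (toℕ-inject₁ u) eq)
  ; father≤ = λ w → ≡.subst (f (inject₁ w) ℕ.≤_) (toℕ-inject₁ w) (father≤ (inject₁ w))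
  }
  where open IsHook h

module _ {n} (T : IncreasingTree n) where

  toℕ-father : ∀ w → toℕ (father T w) ≡ toℕ (T w)
  toℕ-father w = toℕ-inject {i = suc w} (T w)

  descendant-> : ∀ {v u} → HasDescendant T v u → toℕ v ℕ.< toℕ u
  descendant-> [ w , ≡.refl , ≡.refl ] = father-< T w
  descendant-> ((w , ≡.refl , ≡.refl) ∷ p) = ℕ.<-trans (father-< T w) (descendant-> p)

  lookup-hook : ∀ v u → lookup (hook T v) u ≡ does (u ≟ v ⊎-dec descendant? T v u)
  lookup-hook v = lookup∘tabulate λ u → does (u ≟ v ⊎-dec descendant? T v u)

  hook-isHook : IsHook (toℕ ∘ T) (λ v u → lookup (hook T v) u)
  hook-isHook = record
    { self    = λ v → ≡.trans (lookup-hook v v) (dec-true (inHook? v v) (inj₁ ≡.refl))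
    ; below   = λ v u u<v → ≡.trans (lookup-hook v u)
        (dec-false (inHook? v u)
          [ (λ { ≡.refl → ℕ.<-irrefl ≡.refl u<v })
          , (λ p → ℕ.<-asym u<v (descendant-> p)) ]′)
    -- The bound `v≤w` rules out `suc w ≡ v`, so `suc w` can only be a proper descendant of `v`,
    -- which means that its father is in the hook.
    ; step    = λ v w u v≤w eq → ≡.trans (lookup-hook v (suc w))
        (≡.trans
          (does-⇔
            (mk⇔
              (λ { (inj₁ ≡.refl) → contradiction v≤w ℕ.1+n≰n
                 ; (inj₂ p) → via-father⁻¹ T w p })
              (inj₂ ∘ via-father T w))
            (inHook? v (suc w)) (father T w ≟ v ⊎-dec descendant? T v (father T w)))
          (≡.trans (≡.sym (lookup-hook v (father T w)))
            (≡.cong (lookup (hook T v))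
              (toℕ-injective (≡.trans (toℕ-father w) (≡.sym eq))))))
    ; father≤ = λ w → ℕ.≤-pred (toℕ<n (T w))
    }
    where
    inHook? : ∀ v u → Dec (u ≡ v ⊎ HasDescendant T v u)
    inHook? v u = u ≟ v ⊎-dec descendant? T v u

∷-cong : ∀ {m} a {f g : Fin m → ℕ} → f ≗ g → (a Vector.∷ f) ≗ (a Vector.∷ g)
∷-cong a eq zero    = ≡.refl
∷-cong a eq (suc i) = eq i

toℕ-∀-cons : ∀ {m} {b : Fin (suc m) → ℕ} (x : Fin (b zero)) (f : ∀ i → Fin (b (suc i))) →
  (λ i → toℕ (∀-cons {P = Fin ∘ b} x f i)) ≗ (toℕ x Vector.∷ λ i → toℕ (f i))
toℕ-∀-cons x f zero    = ≡.refl
toℕ-∀-cons x f (suc i) = ≡.refl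

module _ {c ℓ} (R : CommutativeRing c ℓ) where
  open CommutativeRing R hiding (zero)
  open import Algebra.Properties.Semiring.Sum semiring
    using (sum-cong-≋; sum-init-last; sum-replicate-zero; ∑-comm; *-distribˡ-sum)
  open import Algebra.Properties.Monoid.Sum *-monoid
    using () renaming (sum-cong-≋ to product-cong; sum-init-last to product-init-last)
  open import Algebra.Properties.Semiring.Mult semiring using () renaming (_×_ to _·_)
  open import Algebra.Properties.Group +-group using (//-rightDividesʳ)
  open import Algebra.Solver.Ring.NaturalCoefficients.Default commutativeSemiring
  open import Relation.Binary.Reasoning.Setoid setoid

  private
    ∑ ∏ : ∀ {n} → (Fin n → Carrier) → Carrier
    ∑ = sum R
    ∏ = product R

  -- Moving the variable of a leaf to its father

  ≈+⇒-≈ : ∀ {a b c} → a ≈ c + b → a - b ≈ c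
  ≈+⇒-≈ {b = b} eq = trans (+-congʳ eq) (//-rightDividesʳ b _)

  if-cong : ∀ b {x y} → x ≈ y → (if b then x else 0#) ≈ (if b then y else 0#)
  if-cong true  eq = eq
  if-cong false eq = refl

  bump : ℕ → Carrier → (ℕ → Carrier) → ℕ → Carrier
  bump zero    a x zero    = x zero + a
  bump zero    a x (suc i) = x (suc i)
  bump (suc j) a x zero    = x zero
  bump (suc j) a x (suc i) = bump j a (x ∘ suc) i

  bump-cong : ∀ j {a b x x′} → a ≈ b → (∀ i → x i ≈ x′ i) → ∀ i → bump j a x i ≈ bump j b x′ i
  bump-cong zero    a≈b eq zero    = +-cong (eq zero) a≈b
  bump-cong zero    a≈b eq (suc i) = eq (suc i)
  bump-cong (suc j) a≈b eq zero    = eq zero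
  bump-cong (suc j) a≈b eq (suc i) = bump-cong j a≈b (eq ∘ suc) i

  -- With `b` the indicator of a hook and `j` the father of a deleted leaf, the term for `b j` is
  -- the contribution of the leaf: a hook of another vertex contains the leaf exactly when it
  -- contains `j`.
  sum-if-bump : ∀ {m} (b : Fin m → Bool) j a x →
    ∑ (λ u → if b u then bump (toℕ j) a x (toℕ u) else 0#) ≈
    ∑ (λ u → if b u then x (toℕ u) else 0#) + (if b j then a else 0#)
  sum-if-bump b zero a x = begin
    (if b zero then x 0 + a else 0#) + s ≈⟨ +-congʳ (if-+ (b zero)) ⟩
    ((if b zero then x 0 else 0#) + (if b zero then a else 0#)) + s
      ≈⟨ solve 3 (λ p q r → (p :+ q) :+ r := (p :+ r) :+ q) refl _ _ _ ⟩
    ((if b zero then x 0 else 0#) + s) + (if b zero then a else 0#) ∎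
    where
    s = ∑ λ u → if b (suc u) then x (suc (toℕ u)) else 0#
    if-+ : ∀ d → (if d then x 0 + a else 0#) ≈ (if d then x 0 else 0#) + (if d then a else 0#)
    if-+ true  = refl
    if-+ false = sym (+-identityˡ 0#)
  sum-if-bump b (suc j) a x =
    trans (+-congˡ (sum-if-bump (b ∘ suc) j a (x ∘ suc))) (sym (+-assoc _ _ _))

  -- Iterated sums over dependent functions

  sumΠ-cong : ∀ {m} (b : Fin m → ℕ) {F G : (∀ i → Fin (b i)) → Carrier} →
    (∀ f → F f ≈ G f) → sumΠ R b F ≈ sumΠ R b G
  sumΠ-cong {zero}  b eq = eq _
  sumΠ-cong {suc m} b eq = sum-cong-≋ {b zero} λ x → sumΠ-cong (b ∘ suc) λ f → eq (∀-cons x f)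

  sumΠ-*ˡ : ∀ {m} (b : Fin m → ℕ) a (F : (∀ i → Fin (b i)) → Carrier) →
    sumΠ R b (λ f → a * F f) ≈ a * sumΠ R b F
  sumΠ-*ˡ {zero}  b a F = refl
  sumΠ-*ˡ {suc m} b a F =
    trans (sum-cong-≋ {b zero} λ x → sumΠ-*ˡ (b ∘ suc) a λ f → F (∀-cons x f))
          (sym (*-distribˡ-sum {b zero} a (λ x → sumΠ R (b ∘ suc) λ f → F (∀-cons x f))))

  -- Bounds that agree only pointwise give different types of functions. Letting `G` see just the
  -- natural number values makes both sides comparable, and `G-cong` stands in for function
  -- extensionality.
  sumΠ-cong-bound : ∀ {m} {b b′ : Fin m → ℕ} (G : (Fin m → ℕ) → Carrier) →
    (∀ {f g} → f ≗ g → G f ≈ G g) → b ≗ b′ →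
    sumΠ R b (λ f → G (toℕ ∘ f)) ≈ sumΠ R b′ (λ f → G (toℕ ∘ f))
  sumΠ-cong-bound {zero}  G G-cong b≗b′ = G-cong λ ()
  sumΠ-cong-bound {suc m} {b} {b′} G G-cong b≗b′ = begin
    (∑ {b zero} λ x → sumΠ R (b ∘ suc) λ f → G (toℕ ∘ ∀-cons {P = Fin ∘ b} x f))
      ≈⟨ sum-cong-≋ {b zero} (λ x → begin
           sumΠ R (b ∘ suc) (λ f → G (toℕ ∘ ∀-cons {P = Fin ∘ b} x f))
             ≈⟨ sumΠ-cong (b ∘ suc) (λ f → G-cong (toℕ-∀-cons {b = b} x f)) ⟩
           sumΠ R (b ∘ suc) (λ f → G (toℕ x Vector.∷ toℕ ∘ f))
             ≈⟨ sumΠ-cong-bound (G ∘ (toℕ x Vector.∷_)) (G-cong ∘ ∷-cong (toℕ x)) (b≗b′ ∘ suc) ⟩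
           sumΠ R (b′ ∘ suc) (λ f → G (toℕ x Vector.∷ toℕ ∘ f)) ∎) ⟩
    (∑ {b zero} λ x → H (toℕ x))
      -- `H` takes a natural number, so the range of the sum can be rewritten without touching the
      -- summand.
      ≡⟨ ≡.cong (λ d → ∑ {d} λ x → H (toℕ x)) (b≗b′ zero) ⟩
    (∑ {b′ zero} λ x → H (toℕ x))
      ≈⟨ sum-cong-≋ {b′ zero} (λ x → sumΠ-cong (b′ ∘ suc) λ f → sym (G-cong (toℕ-∀-cons {b = b′} x f))) ⟩
    (∑ {b′ zero} λ x → sumΠ R (b′ ∘ suc) λ f → G (toℕ ∘ ∀-cons {P = Fin ∘ b′} x f)) ∎
    where
    H : ℕ → Carrier
    H a = sumΠ R (b′ ∘ suc) λ f → G (a Vector.∷ toℕ ∘ f)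

  -- `sumΠ` chooses the first value outermost, whereas removing the last vertex needs the last value
  -- outermost. The bounds do not depend on earlier choices, so the finite sums can be exchanged.
  sumΠ-last : ∀ {m} (b : Fin (suc m) → ℕ) (H : (Fin m → ℕ) → ℕ → Carrier) →
    (∀ {f g} a → f ≗ g → H f a ≈ H g a) →
    sumΠ R b (λ f → H (toℕ ∘ f ∘ inject₁) (toℕ (f (fromℕ m)))) ≈
    ∑ {b (fromℕ m)} λ x → sumΠ R (b ∘ inject₁) λ f → H (toℕ ∘ f) (toℕ x)
  sumΠ-last {zero}  b H H-cong = sum-cong-≋ {b zero} λ x → H-cong (toℕ x) λ ()
  sumΠ-last {suc m} b H H-cong = begin
    (∑ {b zero} λ x → sumΠ R (b ∘ suc) λ f →
      H (toℕ ∘ ∀-cons {P = Fin ∘ b} x f ∘ inject₁) (toℕ (f (fromℕ m))))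
      ≈⟨ sum-cong-≋ {b zero} (λ x → sumΠ-cong (b ∘ suc) λ f →
           H-cong (toℕ (f (fromℕ m))) (∀-cons-inject₁ x f)) ⟩
    (∑ {b zero} λ x → sumΠ R (b ∘ suc) λ f →
      H (toℕ x Vector.∷ toℕ ∘ f ∘ inject₁) (toℕ (f (fromℕ m))))
      ≈⟨ sum-cong-≋ {b zero} (λ x → sumΠ-last (b ∘ suc) (λ g → H (toℕ x Vector.∷ g))
           (λ a eq → H-cong a (∷-cong (toℕ x) eq))) ⟩
    (∑ {b zero} λ x → ∑ {b (fromℕ (suc m))} λ z → L x z)
      ≈⟨ ∑-comm {b zero} {b (fromℕ (suc m))} L ⟩
    (∑ {b (fromℕ (suc m))} λ z → ∑ {b zero} λ x → L x z)
      ≈⟨ sum-cong-≋ {b (fromℕ (suc m))} (λ z → sum-cong-≋ {b zero} λ x →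
           sumΠ-cong (b ∘ suc ∘ inject₁) λ f →
             H-cong (toℕ z) (≡.sym ∘ toℕ-∀-cons {b = b ∘ inject₁} x f)) ⟩
    (∑ {b (fromℕ (suc m))} λ z → sumΠ R (b ∘ inject₁) λ f → H (toℕ ∘ f) (toℕ z)) ∎
    where
    ∀-cons-inject₁ : ∀ x f → toℕ ∘ ∀-cons {P = Fin ∘ b} x f ∘ inject₁ ≗
      (toℕ x Vector.∷ toℕ ∘ f ∘ inject₁)
    ∀-cons-inject₁ x f zero    = ≡.refl
    ∀-cons-inject₁ x f (suc i) = ≡.refl
    L : Fin (b zero) → Fin (b (fromℕ (suc m))) → Carrier
    L x z = sumΠ R (b ∘ suc ∘ inject₁) λ f → H (toℕ x Vector.∷ toℕ ∘ f) (toℕ z)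

  -- The weight of a tree by removal of leaves

  -- The last vertex is its own hook and contributes `1# + x (suc n)`; its variable then passes to
  -- its father. The variables `y` for fathers and `x` for hook sums are kept independent.
  wt : ∀ n → (Fin n → ℕ) → (ℕ → Carrier) → (ℕ → Carrier) → Carrier
  wt zero    f y x = 1#
  wt (suc n) f y x =
    y (f (fromℕ n)) * ((1# + x (suc n)) *
      wt n (f ∘ inject₁) y (bump (f (fromℕ n)) (x (suc n)) x))

  wt-cong : ∀ n {f g} y x → f ≗ g → wt n f y x ≈ wt n g y x
  wt-cong zero    y x eq = refl
  wt-cong (suc n) {f} {g} y x eq rewrite eq (fromℕ n) =
    *-congˡ (*-congˡ (wt-cong n y _ (eq ∘ inject₁)))

  -- Induction on the last vertex: its own hook sum is a single variable, and every other hook sum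
  -- is unchanged when this variable is added to that of the father.
  product-hooks : ∀ n {f D} → IsHook f D → ∀ y x →
    ∏ {n} (λ w → y (f w) * (1# + ∑ λ u → if D (suc w) u then x (toℕ u) else 0#)) ≈ wt n f y x
  product-hooks zero    h y x = refl
  product-hooks (suc n) {f} {D} h y x = begin
    ∏ (λ w → y (f w) * (1# + S (suc w)))
      ≈⟨ product-init-last (λ w → y (f w) * (1# + S (suc w))) ⟩
    ∏ (λ w → y (f (inject₁ w)) * (1# + S (inject₁ (suc w)))) *
      (y (f (fromℕ n)) * (1# + S (fromℕ (suc n))))
      ≈⟨ *-cong (product-cong λ w → *-congˡ (+-congˡ (S-inject₁ w))) (*-congˡ (+-congˡ S-last)) ⟩
    ∏ (λ w → y (f (inject₁ w)) * (1# + S′ (suc w))) * (y (f (fromℕ n)) * (1# + x (suc n)))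
      ≈⟨ *-congʳ (product-hooks n (IsHook-inject₁ h) y x′) ⟩
    wt n (f ∘ inject₁) y x′ * (y (f (fromℕ n)) * (1# + x (suc n)))
      ≈⟨ solve 3 (λ p q r → p :* (q :* r) := q :* (r :* p)) refl _ _ _ ⟩
    wt (suc n) f y x ∎
    where
    open IsHook h
    x′ = bump (f (fromℕ n)) (x (suc n)) x
    S : Fin (suc (suc n)) → Carrier
    S v = ∑ λ u → if D v u then x (toℕ u) else 0#
    S′ : Fin (suc n) → Carrier
    S′ v = ∑ λ u → if D (inject₁ v) (inject₁ u) then x′ (toℕ u) else 0#
    -- By `father≤`, the father of the last vertex has index at most `n`, hence survives in the
    -- smaller tree.
    j : Fin (suc n)
    j = fromℕ< (ℕ.s≤s (≡.subst (f (fromℕ n) ℕ.≤_) (toℕ-fromℕ n) (father≤ (fromℕ n))))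
    toℕ-j : toℕ j ≡ f (fromℕ n)
    toℕ-j = toℕ-fromℕ< _

    S-split : ∀ v → S v ≈
      ∑ (λ u → if D v (inject₁ u) then x (toℕ u) else 0#) +
      (if D v (fromℕ (suc n)) then x (suc n) else 0#)
    S-split v = trans (sum-init-last (λ u → if D v u then x (toℕ u) else 0#))
      (+-cong
        (sum-cong-≋ λ u → if-cong (D v (inject₁ u)) (reflexive (≡.cong x (toℕ-inject₁ u))))
        (if-cong (D v (fromℕ (suc n))) (reflexive (≡.cong x (toℕ-fromℕ (suc n))))))

    S-last : S (fromℕ (suc n)) ≈ x (suc n)
    S-last = begin
      S (fromℕ (suc n)) ≈⟨ S-split (fromℕ (suc n)) ⟩
      _ ≈⟨ +-cong
             (trans (sum-cong-≋ λ u → reflexive (≡.cong (if_then x (toℕ u) else 0#)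
                      (below (fromℕ (suc n)) (inject₁ u)
                        (≡.subst₂ ℕ._<_ (≡.sym (toℕ-inject₁ u)) (≡.sym (toℕ-fromℕ (suc n)))
                          (toℕ<n u)))))
                    (sum-replicate-zero (suc n)))
             (reflexive (≡.cong (if_then x (suc n) else 0#) (self (fromℕ (suc n))))) ⟩
      0# + x (suc n) ≈⟨ +-identityˡ _ ⟩
      x (suc n) ∎

    S-inject₁ : ∀ w → S (inject₁ (suc w)) ≈ S′ (suc w)
    S-inject₁ w = begin
      S v ≈⟨ S-split v ⟩
      ∑ (λ u → if D v (inject₁ u) then x (toℕ u) else 0#) +
        (if D v (fromℕ (suc n)) then x (suc n) else 0#)
        ≡⟨ ≡.cong (λ b → ∑ (λ u → if D v (inject₁ u) then x (toℕ u) else 0#) +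
                         (if b then x (suc n) else 0#))
             (step v (fromℕ n) (inject₁ j)
               (≡.subst₂ ℕ._≤_ (≡.sym (toℕ-inject₁ (suc w))) (≡.sym (toℕ-fromℕ n)) (toℕ<n w))
               (≡.trans (toℕ-inject₁ j) toℕ-j)) ⟩
      ∑ (λ u → if D v (inject₁ u) then x (toℕ u) else 0#) +
        (if D v (inject₁ j) then x (suc n) else 0#)
        ≈⟨ sum-if-bump (D v ∘ inject₁) j (x (suc n)) x ⟨
      ∑ (λ u → if D v (inject₁ u) then bump (toℕ j) (x (suc n)) x (toℕ u) else 0#)
        ≡⟨ ≡.cong (λ i → ∑ λ u →
             if D v (inject₁ u) then bump i (x (suc n)) x (toℕ u) else 0#) toℕ-j ⟩
      S′ (suc w) ∎
      where v = inject₁ (suc w)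

  -- Summing over all trees by the father of the last vertex

  leafSummand : ((ℕ → Carrier) → Carrier) → (ℕ → Carrier) → Carrier → (ℕ → Carrier) → ℕ → Carrier
  leafSummand W y a x j = y j * ((1# + a) * W (bump j a x))

  -- The factor k_{f(2)} = k₁ is left out, so that n counts the vertices besides 1 and 2.
  Q : ℕ → (ℕ → Carrier) → (ℕ → Carrier) → Carrier
  Q zero    y x = 1# + x 1
  Q (suc n) y x = 
    ∑ {suc (suc n)} (leafSummand (Q n y) y (x (suc (suc n))) x ∘ toℕ)

  Q-cong : ∀ n y {x x′} → (∀ i → x i ≈ x′ i) → Q n y x ≈ Q n y x′
  Q-cong zero    y eq = +-congˡ (eq 1)
  Q-cong (suc n) y {x} {x′} eq = sum-cong-≋ {suc (suc n)}
    {leafSummand (Q n y) y (x (suc (suc n))) x ∘ toℕ}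
    {leafSummand (Q n y) y (x′ (suc (suc n))) x′ ∘ toℕ}
    λ j → *-congˡ (*-cong (+-congˡ (eq _)) (Q-cong n y (bump-cong (toℕ j) (eq _) eq)))

  sumWt : ℕ → (ℕ → Carrier) → (ℕ → Carrier) → Carrier
  sumWt n y x = sumTrees R n (λ T → wt n (toℕ ∘ T) y x)

  sumWt-suc : ∀ n y x →
    sumWt (suc n) y x ≈ ∑ {suc n} (leafSummand (sumWt n y) y (x (suc n)) x ∘ toℕ)
  sumWt-suc n y x = begin
    sumWt (suc n) y x
      ≈⟨ sumΠ-last (suc ∘ toℕ) H (λ a eq → *-congˡ (*-congˡ (wt-cong n y _ eq))) ⟩
    (∑ {suc (toℕ (fromℕ n))} λ j → sumΠ R (suc ∘ toℕ ∘ inject₁) λ T → H (toℕ ∘ T) (toℕ j))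
      ≈⟨ sum-cong-≋ {suc (toℕ (fromℕ n))}
           {λ j → sumΠ R (suc ∘ toℕ ∘ inject₁) λ T → H (toℕ ∘ T) (toℕ j)} {L ∘ toℕ}
           (λ j → sum-H (toℕ j)) ⟩
    (∑ {suc (toℕ (fromℕ n))} (L ∘ toℕ))
      ≡⟨ ≡.cong (λ d → ∑ {suc d} (L ∘ toℕ)) (toℕ-fromℕ n) ⟩
    (∑ {suc n} (L ∘ toℕ)) ∎
    where
    a = x (suc n)
    H : (Fin n → ℕ) → ℕ → Carrier
    H f j = y j * ((1# + a) * wt n f y (bump j a x))
    L = leafSummand (sumWt n y) y a x

    sum-H : ∀ j → sumΠ R (suc ∘ toℕ ∘ inject₁) (λ T → H (toℕ ∘ T) j) ≈ L j
    sum-H j = begin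
      sumΠ R b (λ T → y j * ((1# + a) * W (toℕ ∘ T)))
        ≈⟨ sumΠ-*ˡ b (y j) (λ T → (1# + a) * W (toℕ ∘ T)) ⟩
      y j * sumΠ R b (λ T → (1# + a) * W (toℕ ∘ T))
        ≈⟨ *-congˡ (sumΠ-*ˡ b (1# + a) (λ T → W (toℕ ∘ T))) ⟩
      y j * ((1# + a) * sumΠ R b (λ T → W (toℕ ∘ T)))
        ≈⟨ *-congˡ (*-congˡ (sumΠ-cong-bound W (wt-cong n y _) (≡.cong suc ∘ toℕ-inject₁))) ⟩
      L j ∎
      where
      b : Fin n → ℕ
      b = suc ∘ toℕ ∘ inject₁
      W : (Fin n → ℕ) → Carrier
      W f = wt n f y (bump j a x)

  -- The vertex with index 1 is always a son of the root, so every weight contains `y 0`. Both sides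
  -- satisfy the same leaf recursion, through which this factor is pulled out.
  sumWt-Q : ∀ n y x → sumWt (suc n) y x ≈ y 0 * Q n y x
  sumWt-Q zero    y x =
    trans (sumWt-suc 0 y x) (trans (+-identityʳ _) (*-congˡ (*-identityʳ _)))
  sumWt-Q (suc n) y x = begin
    sumWt (suc (suc n)) y x
      ≈⟨ sumWt-suc (suc n) y x ⟩
    ∑ {suc (suc n)} (leafSummand (sumWt (suc n) y) y a x ∘ toℕ)
      ≈⟨ sum-cong-≋ {suc (suc n)} {leafSummand (sumWt (suc n) y) y a x ∘ toℕ}
           {λ j → y 0 * leafSummand (Q n y) y a x (toℕ j)} (λ j → trans
           (*-congˡ (*-congˡ (sumWt-Q n y _)))
           (solve 4 (λ p q r s → p :* (q :* (r :* s)) := r :* (p :* (q :* s))) refl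
             (y (toℕ j)) (1# + a) (y 0) _)) ⟩
    ∑ {suc (suc n)} (λ j → y 0 * leafSummand (Q n y) y a x (toℕ j))
      ≈⟨ *-distribˡ-sum {suc (suc n)} (y 0) (leafSummand (Q n y) y a x ∘ toℕ) ⟨
    y 0 * Q (suc n) y x ∎
    where a = x (suc (suc n))

  -- Contraction of the edge between the first two vertices

  mergeʸ mergeˣ : (ℕ → Carrier) → ℕ → Carrier
  mergeʸ y zero    = y 0 + y 1
  mergeʸ y (suc i) = y (suc (suc i))
  -- The added 1# preserves the relation y = 1 + x; Q does not depend on x 0.
  mergeˣ x zero    = (x 0 + x 1) + 1#
  mergeˣ x (suc i) = x (suc (suc i))

  -- Induction on the last leaf. A leaf on either of the two merged vertices becomes a leaf on the
  -- new root; a leaf on a later vertex stays there, with the index of that vertex lowered by one.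
  Q-contract : ∀ n y x → Q (suc n) y x ≈
    ((1# + x 1) * (y 0 + y 1) + y 1 * ∑ {suc n} λ i → x (suc (suc (toℕ i)))) *
      Q n (mergeʸ y) (mergeˣ x)
  Q-contract zero    y x =
    solve 4 (λ y₀ y₁ x₁ x₂ →
      y₀ :* ((con 1 :+ x₂) :* (con 1 :+ x₁)) :+
        (y₁ :* ((con 1 :+ x₂) :* (con 1 :+ (x₁ :+ x₂))) :+ con 0) :=
      ((con 1 :+ x₁) :* (y₀ :+ y₁) :+ y₁ :* (x₂ :+ con 0)) :* (con 1 :+ x₂))
      refl (y 0) (y 1) (x 1) (x 2)
  Q-contract (suc n) y x = begin
    -- The fathers 0 and 1 are split off. After contraction, they share the cofactor `q`, but their
    -- prefactors differ: only father 1 adds `a` to `x 1`. Any later father adds `a` to `s`, which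
    -- gives `C`.
    y 0 * ((1# + a) * Q (suc n) y (bump 0 a x)) +
      (y 1 * ((1# + a) * Q (suc n) y (bump 1 a x)) +
       ∑ {suc n} (leafSummand (Q (suc n) y) y a x ∘ 2+_))
      ≈⟨ +-cong (*-congˡ (*-congˡ (trans (Q-contract n y _) (*-congˡ (Q-cong n _ merge-bump₀)))))
           (+-cong (*-congˡ (*-congˡ (trans (Q-contract n y _) (*-congˡ (Q-cong n _ merge-bump₁)))))
             (sum-cong-≋ {suc n} {leafSummand (Q (suc n) y) y a x ∘ 2+_}
               {λ j → y (2+ j) * ((1# + a) * (C * q′ j))}
               λ j → *-congˡ (*-congˡ (trans (Q-contract n y _)
               (*-cong (+-congˡ (*-congˡ (sum-bump j))) (Q-cong n _ (merge-bump (toℕ j)))))))) ⟩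
    y 0 * ((1# + a) * (((1# + x 1) * (y 0 + y 1) + y 1 * s) * q)) +
      (y 1 * ((1# + a) * (((1# + (x 1 + a)) * (y 0 + y 1) + y 1 * s) * q)) +
       ∑ {suc n} (λ j → y (2+ j) * ((1# + a) * (C * q′ j))))
      ≈⟨ +-congˡ (+-congˡ (trans
           (sum-cong-≋ {suc n} {λ j → y (2+ j) * ((1# + a) * (C * q′ j))}
             {λ j → C * (y (2+ j) * ((1# + a) * q′ j))}
             λ j → solve 4 (λ p q r s → p :* (q :* (r :* s)) := r :* (p :* (q :* s)))
             refl (y (2+ j)) (1# + a) C (q′ j))
           (sym (*-distribˡ-sum {suc n} C (λ j → y (2+ j) * ((1# + a) * q′ j)))))) ⟩
    y 0 * ((1# + a) * (((1# + x 1) * (y 0 + y 1) + y 1 * s) * q)) +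
      (y 1 * ((1# + a) * (((1# + (x 1 + a)) * (y 0 + y 1) + y 1 * s) * q)) + C * t)
      -- With F the prefactor for father 0, that for father 1 is F + a (y₀ + y₁), and y₀ F + y₁ (F +
      -- a (y₀ + y₁)) = (y₀ + y₁) (F + y₁ a), where F + y₁ a is `C`. So all fathers share the factor
      -- `C`.
      ≈⟨ solve 7 (λ y₀ y₁ x₁ a s q t →
           y₀ :* ((con 1 :+ a) :* (((con 1 :+ x₁) :* (y₀ :+ y₁) :+ y₁ :* s) :* q)) :+
             (y₁ :* ((con 1 :+ a) :* (((con 1 :+ (x₁ :+ a)) :* (y₀ :+ y₁) :+ y₁ :* s) :* q)) :+
               ((con 1 :+ x₁) :* (y₀ :+ y₁) :+ y₁ :* (s :+ a)) :* t) :=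
           ((con 1 :+ x₁) :* (y₀ :+ y₁) :+ y₁ :* (s :+ a)) :*
             ((y₀ :+ y₁) :* ((con 1 :+ a) :* q) :+ t))
           refl (y 0) (y 1) (x 1) a s q t ⟩
    C * ((y 0 + y 1) * ((1# + a) * q) + t)
      ≈⟨ *-congʳ (+-congˡ (*-congˡ s+a)) ⟩
    ((1# + x 1) * (y 0 + y 1) + y 1 * ∑ {suc (suc n)} λ i → x (2+ i)) *
      Q (suc n) (mergeʸ y) (mergeˣ x) ∎
    where
    2+_ : ∀ {m} → Fin m → ℕ
    2+ j = suc (suc (toℕ j))
    a = x (suc (suc (suc n)))
    s = ∑ {suc n} λ i → x (2+ i)
    C = (1# + x 1) * (y 0 + y 1) + y 1 * (s + a)
    q = Q n (mergeʸ y) (bump 0 a (mergeˣ x))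
    q′ : Fin (suc n) → Carrier
    q′ j = Q n (mergeʸ y) (bump (suc (toℕ j)) a (mergeˣ x))
    t = ∑ {suc n} λ j → y (2+ j) * ((1# + a) * q′ j)

    merge-bump₀ : ∀ i → mergeˣ (bump 0 a x) i ≈ bump 0 a (mergeˣ x) i
    merge-bump₀ zero    =
      solve 3 (λ p q r → ((p :+ r) :+ q) :+ con 1 := ((p :+ q) :+ con 1) :+ r) refl (x 0) (x 1) a
    merge-bump₀ (suc i) = refl
    merge-bump₁ : ∀ i → mergeˣ (bump 1 a x) i ≈ bump 0 a (mergeˣ x) i
    merge-bump₁ zero    =
      solve 3 (λ p q r → (p :+ (q :+ r)) :+ con 1 := ((p :+ q) :+ con 1) :+ r) refl (x 0) (x 1) a
    merge-bump₁ (suc i) = refl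
    merge-bump : ∀ j i → mergeˣ (bump (suc (suc j)) a x) i ≈ bump (suc j) a (mergeˣ x) i
    merge-bump j zero    = refl
    merge-bump j (suc i) = refl

    sum-bump : ∀ j → ∑ {suc n} (λ i → bump (2+ j) a x (2+ i)) ≈ s + a
    sum-bump j = sum-if-bump {suc n} (λ _ → true) j a (λ i → x (suc (suc i)))

    s+a : s + a ≈ ∑ {suc (suc n)} λ i → x (2+ i)
    s+a = sym (trans (sum-init-last {suc n} λ i → x (2+ i))
      (+-cong (sum-cong-≋ {suc n} {λ i → x (2+ (inject₁ i))} {λ i → x (2+ i)}
                λ i → reflexive (≡.cong (λ i → x (suc (suc i))) (toℕ-inject₁ i)))
              (reflexive (≡.cong (λ i → x (suc (suc i))) (toℕ-fromℕ (suc n))))))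

  -- The closed form as a falling factorial

  fallingℕ-cong : ∀ {a b} n → a ≈ b → fallingℕ R a n ≈ fallingℕ R b n
  fallingℕ-cong n eq = product-cong {n} λ i → +-congʳ eq

  fallingℕ-suc : ∀ a n → fallingℕ R a (suc n) ≈ fallingℕ R a n * (a - n · 1#)
  fallingℕ-suc a n = trans (product-init-last {n} λ i → a - toℕ i · 1#)
    (*-cong (product-cong {n} λ i → reflexive (≡.cong (λ i → a - i · 1#) (toℕ-inject₁ i)))
            (reflexive (≡.cong (λ i → a - i · 1#) (toℕ-fromℕ n))))

  sum-1+ : ∀ {n} (y x : Fin n → Carrier) → (∀ i → y i ≈ 1# + x i) → ∑ y ≈ n · 1# + ∑ x
  sum-1+ {zero}  y x eq = sym (+-identityˡ 0#)
  sum-1+ {suc n} y x eq = trans (+-cong (eq zero) (sum-1+ (y ∘ suc) (x ∘ suc) (eq ∘ suc)))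
    (solve 4 (λ a b c d → (a :+ b) :+ (c :+ d) := (a :+ c) :+ (b :+ d)) refl _ _ _ _)

  -- Contraction keeps the relation between `y` and `x` as well as the total of `y`. The product
  -- omits the root, so the merged variable does not enter it, and the contraction factor supplies
  -- `y 1` together with the next factor of the falling factorial.
  Q-1+ : ∀ n y x → (∀ i → y i ≈ 1# + x i) →
    Q n y x ≈ ∏ {suc n} (λ i → y (suc (toℕ i))) *
      fallingℕ R (∑ {suc (suc n)} (λ i → y (toℕ i)) - 1#) n
  Q-1+ zero    y x y≈1+x =
    trans (sym (y≈1+x 1)) (sym (trans (*-identityʳ _) (*-identityʳ _)))
  Q-1+ (suc n) y x y≈1+x = begin
    Q (suc n) y x
      ≈⟨ Q-contract n y x ⟩
    ((1# + x 1) * (y 0 + y 1) + y 1 * s) * Q n (mergeʸ y) (mergeˣ x)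
      ≈⟨ *-cong (+-congʳ (*-congʳ (sym (y≈1+x 1))))
           (trans (Q-1+ n (mergeʸ y) (mergeˣ x) merged)
             (*-congˡ (fallingℕ-cong n (+-congʳ (+-assoc (y 0) (y 1) _))))) ⟩
    (y 1 * (y 0 + y 1) + y 1 * s) * (p * fallingℕ R (K - 1#) n)
      ≈⟨ solve 5 (λ y₀ y₁ s p f →
           (y₁ :* (y₀ :+ y₁) :+ y₁ :* s) :* (p :* f) :=
           (y₁ :* p) :* (f :* ((y₀ :+ y₁) :+ s))) refl (y 0) (y 1) s p _ ⟩
    (y 1 * p) * (fallingℕ R (K - 1#) n * ((y 0 + y 1) + s))
      ≈⟨ *-congˡ (*-congˡ last-factor) ⟨
    (y 1 * p) * (fallingℕ R (K - 1#) n * ((K - 1#) - n · 1#))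
      ≈⟨ *-congˡ (fallingℕ-suc (K - 1#) n) ⟨
    (y 1 * p) * fallingℕ R (K - 1#) (suc n) ∎
    where
    s = ∑ {suc n} λ i → x (suc (suc (toℕ i)))
    p = ∏ {suc n} λ i → y (suc (suc (toℕ i)))
    K = ∑ {suc (suc (suc n))} λ i → y (toℕ i)

    merged : ∀ i → mergeʸ y i ≈ 1# + mergeˣ x i
    merged zero    = trans (+-cong (y≈1+x 0) (y≈1+x 1))
      (solve 2 (λ a b → (con 1 :+ a) :+ (con 1 :+ b) := con 1 :+ ((a :+ b) :+ con 1))
        refl (x 0) (x 1))
    merged (suc i) = y≈1+x (suc (suc i))

    -- Writing the last n + 1 terms of `K` as `1# + x` gives K = y₀ + y₁ + (n + 1) + s.
    last-factor : (K - 1#) - n · 1# ≈ (y 0 + y 1) + s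
    last-factor = ≈+⇒-≈ (≈+⇒-≈ (begin
      y 0 + (y 1 + ∑ {suc n} λ i → y (suc (suc (toℕ i))))
        ≈⟨ +-congˡ (+-congˡ (sum-1+ {suc n} (λ i → y (suc (suc (toℕ i))))
             (λ i → x (suc (suc (toℕ i)))) λ i → y≈1+x (suc (suc (toℕ i))))) ⟩
      y 0 + (y 1 + ((1# + n · 1#) + s))
        ≈⟨ solve 4 (λ a b c d → a :+ (b :+ ((con 1 :+ c) :+ d)) := (((a :+ b) :+ d) :+ c) :+ con 1)
             refl (y 0) (y 1) (n · 1#) s ⟩
      (((y 0 + y 1) + s) + n · 1#) + 1# ∎))

  -- Specialisation to the weights of the theorem

  sumOver-1+ : ∀ {m} (S : Subset m) (y x : Fin m → Carrier) → (∀ u → y u ≈ 1# + x u) →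
    sumOver R S y ≈ sumOver R S x + ∣ S ∣ · 1#
  sumOver-1+ []          y x eq = sym (+-identityʳ 0#)
  sumOver-1+ (true ∷ S)  y x eq =
    trans (+-cong (eq zero) (sumOver-1+ S (y ∘ suc) (x ∘ suc) (eq ∘ suc)))
      (solve 4 (λ a b c d → (a :+ b) :+ (c :+ d) := (b :+ c) :+ (a :+ d)) refl _ _ _ _)
  sumOver-1+ (false ∷ S) y x eq =
    trans (+-congˡ (sumOver-1+ S (y ∘ suc) (x ∘ suc) (eq ∘ suc))) (sym (+-assoc _ _ _))

  -- Each vertex of a hook contributes 1 to its size, so subtracting the size turns the sum of `k`
  -- into the sum of `x`, the form treated by `product-hooks`.
  weight-wt : ∀ {n} (k : Fin (suc n) → Carrier) y x → (∀ u → k u ≈ y (toℕ u)) →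
    (∀ i → y i ≈ 1# + x i) → ∀ T → weight R k T ≈ wt n (toℕ ∘ T) y x
  weight-wt {n} k y x k≈y y≈1+x T =
    trans (product-cong {n} λ w → *-cong
            (trans (k≈y (father T w)) (reflexive (≡.cong y (toℕ-father T w))))
            (trans (+-congʳ (≈+⇒-≈
                     (sumOver-1+ (hook T (suc w)) k (x ∘ toℕ)
                       (λ u → trans (k≈y u) (y≈1+x (toℕ u))))))
                   (+-comm _ 1#)))
          (product-hooks n (hook-isHook T) y x)

  extend : ∀ {n} → (Fin n → Carrier) → ℕ → Carrier
  -- Default value beyond the last vertex; `y≈1+x` still holds there because `x` is defined as `y`
  -- minus 1 at every index.
  extend {zero}  k i       = 0#
  extend {suc n} k zero    = k zero
  extend {suc n} k (suc i) = extend (k ∘ suc) i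

  extend-toℕ : ∀ {n} (k : Fin n → Carrier) i → k i ≈ extend k (toℕ i)
  extend-toℕ k zero    = refl
  extend-toℕ k (suc i) = extend-toℕ (k ∘ suc) i

  sumTrees-weight : ∀ n (k : Fin (suc (suc n)) → Carrier) →
    sumTrees R (suc n) (weight R k) ≈ ∏ k * fallingℕ R (∑ k - 1#) n
  sumTrees-weight n k = begin
    sumTrees R (suc n) (weight R k)
      ≈⟨ sumΠ-cong (suc ∘ toℕ) (weight-wt k y x (extend-toℕ k) y≈1+x) ⟩
    sumWt (suc n) y x
      ≈⟨ sumWt-Q n y x ⟩
    y 0 * Q n y x
      ≈⟨ *-congˡ (Q-1+ n y x y≈1+x) ⟩
    y 0 * (∏ {suc n} (λ i → y (suc (toℕ i))) * fallingℕ R (∑ {suc (suc n)} (y ∘ toℕ) - 1#) n)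
      ≈⟨ *-assoc _ _ _ ⟨
    ∏ {suc (suc n)} (y ∘ toℕ) * fallingℕ R (∑ {suc (suc n)} (y ∘ toℕ) - 1#) n
      ≈⟨ *-cong (product-cong {suc (suc n)} {k} {y ∘ toℕ} (extend-toℕ k))
           (fallingℕ-cong n (+-congʳ (sum-cong-≋ {suc (suc n)} {k} {y ∘ toℕ} (extend-toℕ k)))) ⟨
    ∏ k * fallingℕ R (∑ k - 1#) n ∎
    where
    y x : ℕ → Carrier
    y = extend k
    x i = y i - 1#
    y≈1+x : ∀ i → y i ≈ 1# + x i
    y≈1+x i = sym (trans (+-comm 1# _) (trans (+-assoc _ _ _)
      (trans (+-congˡ (-‿inverseˡ 1#)) (+-identityʳ _))))

  -- The exponent r - 2, including the negative case

  fallingℕ-1 : ∀ a → fallingℕ R ((a - 1#) + 1 · 1#) 1 ≈ a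
  fallingℕ-1 a = begin
    (((a - 1#) + (1# + 0#)) - 0#) * 1# ≈⟨ *-identityʳ _ ⟩
    ((a - 1#) + (1# + 0#)) - 0#
      ≈⟨ ≈+⇒-≈ (trans (+-congˡ (+-identityʳ 1#)) (trans (+-assoc _ _ _)
           (+-cong refl (-‿inverseˡ 1#)))) ⟩
    a ∎

theorem1p1 : ∀ {c ℓ} (R : CommutativeRing c ℓ) →
    let open CommutativeRing R in
    (n : ℕ) (k : Fin (suc n) → Carrier) →
    let r = suc n
        K = sum R k
    in (defined : FallingDefined R (K - 1#) (+ r ℤ.- + 2)) →
       sumTrees R n (weight R k) ≈ product R k * falling R (K - 1#) (+ r ℤ.- + 2) defined
-- For r = 1 the only tree has weight 1, and the exponent -1 makes the falling factorial the inverse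
-- of K, which is the single variable.
theorem1p1 R zero k (k⁻¹ , _ , inverseʳ) =
  sym (trans (*-congʳ (trans (*-identityʳ _)
               (sym (trans (fallingℕ-1 R _) (+-identityʳ _))))) inverseʳ)
  where open CommutativeRing R
theorem1p1 R (suc n) k _ = sumTrees-weight R n k
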